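{- Let $D=\mathrm{diag}(1,-1,1,-1,\ldots)=(1,-x)$, $\mathbb{F}^{\rm S}=(1,x(1+x))$, $\mathbb{L}^{\rm S}=(1+2x,x(1+x))$, and write $D(\mathbb{F}^{\rm S})^{ -1}D=[r_{ij}]_{i,j\ge0}$ and $D(\mathbb{L}^{\rm S})^{ -1}D=[q_{ij}]_{i,j\ge0}$. Then: (a) $r_{00}=1$, and for $i=1,2,\ldots$ and $j=2,3,\ldots$: $r_{i0}=0$, $r_{i1}=\frac{1}{i}\binom{2i-2}{i-1}$, and $r_{ij}=-r_{i-1,j-2}+r_{i,j-1}$. (b) $q_{i0}=\binom{2i}{i}$ for $i=0,1,2,\ldots$; $q_{i1}=\frac12\binom{2i}{i}$ for $i=1,2,\ldots$; and $q_{ij}=-q_{i-1,j-2}+q_{i,j-1}$ for $i=1,2,\ldots$, $j=2,3,\ldots$.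
   Context: All matrices are infinite with rows and columns indexed by $0,1,2,\ldots$. For formal power series $g(x)=g_0+g_1x+\cdots$ with $g_0\ne0$ and $f(x)=f_1x+f_2x^2+\cdots$ with $f_1\ne0$, $(g(x),f(x))$ denotes the (Riordan) infinite lower triangular matrix whose $j$-th column has generating function $g(x)f(x)^j$. These matrices form a group under matrix multiplication with $(g,f)(h,l)=(g\cdot h(f),l(f))$. -}

module Defs where

open import Algebra.Bundles using (CommutativeRing)
open import Algebra.Definitions using (Invertible)
open import Data.Bool.Base using (if_then_else_)
open import Data.Fin.Base using (toℕ)
open import Data.Fin.Properties using (toℕ<n)
open import Data.Nat.Base as ℕ using (ℕ; zero; suc; _∸_; _<_; z≤n; s≤s)
open import Data.Nat.Induction using (<-rec)
import Data.Nat.Properties as ℕₚ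
open import Data.Product.Base using (_,_; proj₁; proj₂)
open import Data.Rational
  using (ℚ; 0ℚ; 1ℚ; _+_; _*_; -_; _-_; 1/_; ≢-nonZero)
open import Data.Rational.Properties
  using (+-*-commutativeRing; +-identityˡ; +-identityʳ; +-assoc; +-comm;
         +-inverseˡ; *-assoc; *-comm; *-identityˡ; *-identityʳ; *-zeroˡ; *-zeroʳ;
         *-inverseʳ; *-inverseˡ; neg-distribˡ-*)
open import Function.Base using (_∘_)
open import Relation.Binary.PropositionalEquality
open import Relation.Nullary using (does; yes; no; contradiction)
open import Relation.Nullary.Decidable using (dec-true; dec-false)

open import Algebra.Properties.Semiring.Sum
  (CommutativeRing.semiring +-*-commutativeRing)
  using (∑-comm; *-distribˡ-sum; *-distribʳ-sum; sum-cong-≗; sum⁺-syntax; sum-syntax)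

-- The sequence of coefficients: f n is the coefficient of xⁿ.
Series : Set
Series = ℕ → ℚ

constant : ℚ → Series
constant c zero    = c
constant c (suc _) = 0ℚ

x : Series
x zero          = 0ℚ
x (suc zero)    = 1ℚ
x (suc (suc _)) = 0ℚ

infixl 6 _+ₛ_
infixl 7 _*ₛ_
infix  8 -ₛ_
infixr 8 _^ₛ_

_+ₛ_ : Series → Series → Series
(f +ₛ g) n = f n + g n

-ₛ_ : Series → Series
(-ₛ f) n = - f n

_*ₛ_ : Series → Series → Series
(f *ₛ g) n = ∑[ k ≤ n ] (f (toℕ k) * g (n ∸ toℕ k))

_^ₛ_ : Series → ℕ → Series
f ^ₛ zero  = constant 1ℚ
f ^ₛ suc n = f *ₛ f ^ₛ n

record LowerTriangular : Set where
  constructor lowerTriangular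
  field
    entry : ℕ → ℕ → ℚ
    lower : ∀ {i j} → i < j → entry i j ≡ 0ℚ

open LowerTriangular public

infix 4 _≈_

_≈_ : LowerTriangular → LowerTriangular → Set
A ≈ B = ∀ i j → entry A i j ≡ entry B i j

diag : (ℕ → ℚ) → LowerTriangular
diag d = lowerTriangular
  (λ i j → if does (i ℕₚ.≟ j) then d i else 0ℚ)
  (λ {i} {j} i<j →
    cong (if_then d i else 0ℚ) (dec-false (i ℕₚ.≟ j) (ℕₚ.<⇒≢ i<j)))

I : LowerTriangular
I = diag (λ _ → 1ℚ)

∑< : ℕ → (ℕ → ℚ) → ℚ
∑< n f = ∑[ k < n ] f (toℕ k)

∑<-cong : ∀ n {f g : ℕ → ℚ} → (∀ k → k < n → f k ≡ g k) → ∑< n f ≡ ∑< n g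
∑<-cong n eq = sum-cong-≗ {n} (λ k → eq (toℕ k) (toℕ<n k))

∑<-zero : ∀ n {f : ℕ → ℚ} → (∀ k → k < n → f k ≡ 0ℚ) → ∑< n f ≡ 0ℚ
∑<-zero zero    eq = refl
∑<-zero (suc n) eq =
  trans (cong₂ _+_ (eq 0 (s≤s z≤n)) (∑<-zero n (λ k k<n → eq (suc k) (s≤s k<n))))
        (+-identityˡ 0ℚ)

∑<-snoc : ∀ n (f : ℕ → ℚ) → ∑< (suc n) f ≡ ∑< n f + f n
∑<-snoc zero    f = trans (+-identityʳ (f 0)) (sym (+-identityˡ (f 0)))
∑<-snoc (suc n) f =
  trans (cong (f 0 +_) (∑<-snoc n (f ∘ suc)))
        (sym (+-assoc (f 0) (∑< n (f ∘ suc)) (f (suc n))))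

∑<-extend : ∀ {m n} {f : ℕ → ℚ} → m ℕ.≤ n →
           (∀ k → m ℕ.≤ k → f k ≡ 0ℚ) → ∑< n f ≡ ∑< m f
∑<-extend {n = n} z≤n   eq = ∑<-zero n (λ k _ → eq k z≤n)
∑<-extend {f = f} (s≤s m≤n) eq =
  cong (f 0 +_) (∑<-extend m≤n (λ k m≤k → eq (suc k) (s≤s m≤k)))

∑<-single : ∀ n i {f : ℕ → ℚ} → i < n →
           (∀ k → k < n → k ≢ i → f k ≡ 0ℚ) → ∑< n f ≡ f i
∑<-single (suc n) zero {f} _ eq =
  trans (cong (f 0 +_) (∑<-zero n (λ k k<n → eq (suc k) (s≤s k<n) λ ())))
        (+-identityʳ (f 0))
∑<-single (suc n) (suc i) {f} (s≤s i<n) eq =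
  trans (cong₂ _+_ (eq 0 (s≤s z≤n) λ ())
                   (∑<-single n i i<n (λ k k<n k≢i →
                      eq (suc k) (s≤s k<n) (k≢i ∘ ℕₚ.suc-injective))))
        (+-identityˡ (f (suc i)))

∑<-*ˡ : ∀ n p (f : ℕ → ℚ) → p * ∑< n f ≡ ∑< n (λ k → p * f k)
∑<-*ˡ n p f = *-distribˡ-sum {n} p (f ∘ toℕ)

∑<-*ʳ : ∀ n p (f : ℕ → ℚ) → ∑< n f * p ≡ ∑< n (λ k → f k * p)
∑<-*ʳ n p f = *-distribʳ-sum {n} p (f ∘ toℕ)

0*≡0 : ∀ {p} q → p ≡ 0ℚ → p * q ≡ 0ℚ
0*≡0 q refl = *-zeroˡ q

*0≡0 : ∀ p {q} → q ≡ 0ℚ → p * q ≡ 0ℚ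
*0≡0 p refl = *-zeroʳ p

diag-on : ∀ d i → entry (diag d) i i ≡ d i
diag-on d i = cong (if_then d i else 0ℚ) (dec-true (i ℕₚ.≟ i) refl)

diag-off : ∀ d {i j} → i ≢ j → entry (diag d) i j ≡ 0ℚ
diag-off d {i} {j} i≢j =
  cong (if_then d i else 0ℚ) (dec-false (i ℕₚ.≟ j) i≢j)

infixl 7 _·_

-- Row i of A vanishes beyond column i, so the sum over all k stops at k = i.
_·_ : LowerTriangular → LowerTriangular → LowerTriangular
A · B = lowerTriangular
  (λ i j → ∑[ k ≤ i ] (entry A i (toℕ k) * entry B (toℕ k) j))
  (λ {i} {j} i<j → ∑<-zero (suc i) {λ k → entry A i k * entry B k j} λ k k≤i →
    *0≡0 (entry A i k) (lower B (ℕₚ.<-≤-trans k≤i i<j)))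

·-cong : ∀ {A A′ B B′} → A ≈ A′ → B ≈ B′ → A · B ≈ A′ · B′
·-cong {A} {A′} {B} {B′} p q i j =
  ∑<-cong (suc i) {λ k → entry A i k * entry B k j}
                 {λ k → entry A′ i k * entry B′ k j}
    (λ k _ → cong₂ _*_ (p i k) (q k j))

·-identityˡ : ∀ A → I · A ≈ A
·-identityˡ A i j =
  trans (∑<-single (suc i) i {λ k → entry I i k * entry A k j} (ℕₚ.n<1+n i)
           (λ k _ k≢i → 0*≡0 (entry A k j) (diag-off _ (k≢i ∘ sym))))
        (trans (cong (_* entry A i j) (diag-on _ i)) (*-identityˡ _))

·-identityʳ : ∀ A → A · I ≈ A
·-identityʳ A i j with i ℕₚ.<? j
... | yes i<j = trans (lower (A · I) i<j) (sym (lower A i<j))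
... | no  i≮j =
  trans (∑<-single (suc i) j {λ k → entry A i k * entry I k j} (s≤s (ℕₚ.≮⇒≥ i≮j))
           (λ k _ k≢j → *0≡0 (entry A i k) (diag-off _ k≢j)))
        (trans (cong (entry A i j *_) (diag-on _ j)) (*-identityʳ _))

·-assoc : ∀ A B C → (A · B) · C ≈ A · (B · C)
·-assoc A B C i j = begin
  ∑< n (λ k → ∑< n (λ l → a l * b l k) * c k)
    ≡⟨ ∑<-cong n {λ k → ∑< n (λ l → a l * b l k) * c k}
                  {λ k → ∑< n (λ l → a l * b l k * c k)}
         (λ k _ → ∑<-*ʳ n (c k) (λ l → a l * b l k)) ⟩
  ∑< n (λ k → ∑< n (λ l → a l * b l k * c k))
    ≡⟨ ∑-comm {n} {n} (λ k l → a (toℕ l) * b (toℕ l) (toℕ k) * c (toℕ k)) ⟩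
  ∑< n (λ l → ∑< n (λ k → a l * b l k * c k))
    ≡⟨ ∑<-cong n {λ l → ∑< n (λ k → a l * b l k * c k)}
                  {λ l → ∑< n (λ k → a l * (b l k * c k))}
         (λ l _ → ∑<-cong n {λ k → a l * b l k * c k} {λ k → a l * (b l k * c k)}
           (λ k _ → *-assoc (a l) (b l k) (c k))) ⟩
  ∑< n (λ l → ∑< n (λ k → a l * (b l k * c k)))
    ≡⟨ ∑<-cong n {λ l → a l * ∑< n (λ k → b l k * c k)}
                  {λ l → ∑< n (λ k → a l * (b l k * c k))}
         (λ l _ → ∑<-*ˡ n (a l) (λ k → b l k * c k)) ⟨
  ∑< n (λ l → a l * ∑< n (λ k → b l k * c k))
    ≡⟨ ∑<-cong n {λ l → a l * ∑< n (λ k → b l k * c k)}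
                  {λ l → a l * ∑< (suc l) (λ k → b l k * c k)}
         (λ l l<n → cong (a l *_)
           (∑<-extend {f = λ k → b l k * c k} l<n (λ k l<k → 0*≡0 (c k) (lower B l<k)))) ⟩
  ∑< n (λ l → a l * ∑< (suc l) (λ k → b l k * c k)) ∎
  where
  open ≡-Reasoning
  n = suc i
  a = entry A i
  b = entry B
  c = λ k → entry C k j

module RightInverse (A : LowerTriangular) (A≢0 : ∀ i → entry A i i ≢ 0ℚ) where

  recip : ℕ → ℚ
  recip i = (1/ entry A i i) {{≢-nonZero (A≢0 i)}}

  -- Forward substitution in column j: the i-th unknown from the previous ones.
  step : ℕ → ℕ → (ℕ → ℚ) → ℚ
  step j i b = recip i * (entry I i j - ∑< i (λ k → entry A i k * b k))

  table : ℕ → ℕ → ℕ → ℚ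
  table j zero    i = 0ℚ
  table j (suc n) i = if does (i ℕₚ.≟ n) then step j n (table j n) else table j n i

  solution : ℕ → ℕ → ℚ
  solution i j = table j (suc i) i

  table-stable : ∀ j n i → i < n → table j n i ≡ solution i j
  table-stable j (suc n) i (s≤s i≤n) with i ℕₚ.≟ n
  ... | yes refl = refl
  ... | no i≢n   =
    trans (cong (if_then step j n (table j n) else table j n i)
                (dec-false (i ℕₚ.≟ n) i≢n))
          (table-stable j n i (ℕₚ.≤∧≢⇒< i≤n i≢n))

  solution-step : ∀ i j → solution i j ≡ step j i (λ k → solution k j)
  solution-step i j =
    trans (cong (if_then step j i (table j i) else table j i i)
                (dec-true (i ℕₚ.≟ i) refl))
          (cong (λ s → recip i * (entry I i j - s))
                (∑<-cong i (λ k k<i → cong (entry A i k *_) (table-stable j i k k<i))))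

  solution-lower : ∀ {j} i → i < j → solution i j ≡ 0ℚ
  solution-lower {j} = <-rec (λ i → i < j → solution i j ≡ 0ℚ) λ i rec i<j →
    trans (solution-step i j)
          (*0≡0 (recip i)
            (cong₂ _-_ (lower I i<j)
                       (∑<-zero i (λ k k<i →
                         *0≡0 (entry A i k) (rec k<i (ℕₚ.<-trans k<i i<j))))))

  B : LowerTriangular
  B = lowerTriangular solution (solution-lower _)

  A·B≈I : A · B ≈ I
  A·B≈I i j = begin
    ∑< (suc i) (λ k → entry A i k * solution k j)
      ≡⟨ ∑<-snoc i (λ k → entry A i k * solution k j) ⟩
    s + entry A i i * solution i j
      ≡⟨ cong (λ t → s + entry A i i * t) (solution-step i j) ⟩
    s + entry A i i * (recip i * (entry I i j - s))
      ≡⟨ cong (s +_) (*-assoc (entry A i i) (recip i) _) ⟨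
    s + entry A i i * recip i * (entry I i j - s)
      ≡⟨ cong (λ t → s + t * (entry I i j - s))
           (*-inverseʳ (entry A i i) {{≢-nonZero (A≢0 i)}}) ⟩
    s + 1ℚ * (entry I i j - s)
      ≡⟨ cong (s +_) (*-identityˡ (entry I i j - s)) ⟩
    s + (entry I i j - s)
      ≡⟨ +-comm s (entry I i j - s) ⟩
    entry I i j - s + s
      ≡⟨ +-assoc (entry I i j) (- s) s ⟩
    entry I i j + (- s + s)
      ≡⟨ cong (entry I i j +_) (+-inverseˡ s) ⟩
    entry I i j + 0ℚ
      ≡⟨ +-identityʳ (entry I i j) ⟩
    entry I i j ∎
    where
    open ≡-Reasoning
    s = ∑< i (λ k → entry A i k * solution k j)

  B≢0 : ∀ i → entry B i i ≢ 0ℚ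
  B≢0 i Bᵢᵢ≡0 = contradiction (trans (sym (diag-on _ i)) (trans (sym (A·B≈I i i))
    (∑<-zero (suc i) {λ k → entry A i k * entry B k i} vanish))) λ ()
    where
    vanish : ∀ k → k < suc i → entry A i k * entry B k i ≡ 0ℚ
    vanish k (s≤s k≤i) with k ℕₚ.≟ i
    ... | yes refl = *0≡0 (entry A i i) Bᵢᵢ≡0
    ... | no k≢i   = *0≡0 (entry A i k) (lower B (ℕₚ.≤∧≢⇒< k≤i k≢i))

invertible : ∀ A → (∀ i → entry A i i ≢ 0ℚ) → Invertible _≈_ I _·_ A
invertible A A≢0 = B , B·A≈I , A·B≈I
  where
  open RightInverse A A≢0
  open RightInverse B B≢0 using () renaming (B to C; A·B≈I to B·C≈I)

  A≈C : A ≈ C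
  A≈C i j = begin
    entry A i j             ≡⟨ ·-identityʳ A i j ⟨
    entry (A · I) i j       ≡⟨ ·-cong {A} {A} {B · C} {I} (λ _ _ → refl) B·C≈I i j ⟨
    entry (A · (B · C)) i j ≡⟨ ·-assoc A B C i j ⟨
    entry ((A · B) · C) i j ≡⟨ ·-cong {A · B} {I} {C} {C} A·B≈I (λ _ _ → refl) i j ⟩
    entry (I · C) i j       ≡⟨ ·-identityˡ C i j ⟩
    entry C i j             ∎
    where open ≡-Reasoning

  B·A≈I : B · A ≈ I
  B·A≈I i j =
    trans (·-cong {B} {B} {A} {C} (λ _ _ → refl) A≈C i j) (B·C≈I i j)

record RiordanPair : Set where
  field
    g    : Series
    f    : Series
    g₀≢0 : g 0 ≢ 0ℚ
    f₀≡0 : f 0 ≡ 0ℚ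
    f₁≢0 : f 1 ≢ 0ℚ

*≢0 : ∀ {p q} → p ≢ 0ℚ → q ≢ 0ℚ → p * q ≢ 0ℚ
*≢0 {p} {q} p≢0 q≢0 pq≡0 = q≢0 (begin
  q                ≡⟨ *-identityˡ q ⟨
  1ℚ * q           ≡⟨ cong (_* q) (*-inverseˡ p) ⟨
  1/ p * p * q     ≡⟨ *-assoc (1/ p) p q ⟩
  1/ p * (p * q)   ≡⟨ *0≡0 (1/ p) pq≡0 ⟩
  0ℚ               ∎)
  where
  open ≡-Reasoning
  instance _ = ≢-nonZero p≢0

module _ {f : Series} (f₀≡0 : f 0 ≡ 0ℚ) where

  ^-lower : ∀ j {i} → i < j → (f ^ₛ j) i ≡ 0ℚ
  ^-lower (suc j) {i} (s≤s i≤j) =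
    ∑<-zero (suc i) {λ k → f k * (f ^ₛ j) (i ∸ k)} λ where
      zero    _         → 0*≡0 ((f ^ₛ j) i) f₀≡0
      (suc k) (s≤s k<i) → *0≡0 (f (suc k))
        (^-lower j (ℕₚ.<-≤-trans (ℕₚ.∸-monoʳ-< (s≤s z≤n) k<i) i≤j))

  ^-diagonal : ∀ j → (f ^ₛ suc j) (suc j) ≡ f 1 * (f ^ₛ j) j
  ^-diagonal j =
    ∑<-single (suc (suc j)) 1 {λ k → f k * (f ^ₛ j) (suc j ∸ k)} (s≤s (s≤s z≤n)) λ where
      zero          _               _   → 0*≡0 ((f ^ₛ j) (suc j)) f₀≡0
      (suc zero)    _               1≢1 → contradiction refl 1≢1
      (suc (suc k)) (s≤s (s≤s k<j)) _   → *0≡0 (f (suc (suc k)))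
        (^-lower j (ℕₚ.∸-monoʳ-< (s≤s z≤n) k<j))

  ^-diagonal≢0 : f 1 ≢ 0ℚ → ∀ j → (f ^ₛ j) j ≢ 0ℚ
  ^-diagonal≢0 f₁≢0 zero    = λ ()
  ^-diagonal≢0 f₁≢0 (suc j) eq =
    *≢0 f₁≢0 (^-diagonal≢0 f₁≢0 j) (trans (sym (^-diagonal j)) eq)

riordan : RiordanPair → LowerTriangular
riordan P = lowerTriangular
  (λ i j → (g *ₛ f ^ₛ j) i)
  (λ {i} {j} i<j → ∑<-zero (suc i) {λ k → g k * (f ^ₛ j) (i ∸ k)} λ k _ →
    *0≡0 (g k) (^-lower f₀≡0 j (ℕₚ.≤-<-trans (ℕₚ.m∸n≤m i k) i<j)))
  where open RiordanPair P

riordan-invertible : ∀ P → Invertible _≈_ I _·_ (riordan P)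
riordan-invertible P = invertible (riordan P) λ i eq →
  *≢0 g₀≢0 (^-diagonal≢0 f₀≡0 f₁≢0 i) (trans (sym (diagonal i)) eq)
  where
  open RiordanPair P
  diagonal : ∀ i → entry (riordan P) i i ≡ g 0 * (f ^ₛ i) i
  diagonal i =
    ∑<-single (suc i) 0 {λ k → g k * (f ^ₛ i) (i ∸ k)} (s≤s z≤n) λ where
      zero    _         0≢0 → contradiction refl 0≢0
      (suc k) (s≤s k<i) _   → *0≡0 (g (suc k))
        (^-lower f₀≡0 i (ℕₚ.∸-monoʳ-< (s≤s z≤n) k<i))

infix 8 _⁻¹

_⁻¹ : RiordanPair → LowerTriangular
P ⁻¹ = proj₁ (riordan-invertible P)

𝔽ˢ : RiordanPair
𝔽ˢ = record
  { g    = constant 1ℚ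
  ; f    = x *ₛ (constant 1ℚ +ₛ x)
  ; g₀≢0 = λ ()
  ; f₀≡0 = refl
  ; f₁≢0 = λ ()
  }

𝕃ˢ : RiordanPair
𝕃ˢ = record
  { g    = constant 1ℚ +ₛ constant (1ℚ + 1ℚ) *ₛ x
  ; f    = x *ₛ (constant 1ℚ +ₛ x)
  ; g₀≢0 = λ ()
  ; f₀≡0 = refl
  ; f₁≢0 = λ ()
  }

sign : ℕ → ℚ
sign zero    = 1ℚ
sign (suc n) = - sign n

D : LowerTriangular
D = diag sign

⟨1,-x⟩ : RiordanPair
⟨1,-x⟩ = record
  { g    = constant 1ℚ
  ; f    = -ₛ x
  ; g₀≢0 = λ ()
  ; f₀≡0 = refl
  ; f₁≢0 = λ ()
  }

D≈⟨1,-x⟩ : D ≈ riordan ⟨1,-x⟩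
D≈⟨1,-x⟩ i j = sym (trans (one* ((-ₛ x) ^ₛ j) i) (power j i))
  where
  one* : ∀ h n → (constant 1ℚ *ₛ h) n ≡ h n
  one* h n =
    trans (∑<-single (suc n) 0 {λ k → constant 1ℚ k * h (n ∸ k)} (s≤s z≤n) λ where
             zero    _ 0≢0 → contradiction refl 0≢0
             (suc k) _ _   → *-zeroˡ (h (n ∸ suc k)))
          (*-identityˡ (h n))

  shift : ∀ h n → ((-ₛ x) *ₛ h) (suc n) ≡ - h n
  shift h n =
    trans (∑<-single (suc (suc n)) 1 {λ k → (-ₛ x) k * h (suc n ∸ k)} (s≤s (s≤s z≤n)) λ where
             zero          _ _   → *-zeroˡ (h (suc n))
             (suc zero)    _ 1≢1 → contradiction refl 1≢1
             (suc (suc k)) _ _   → *-zeroˡ (h (suc n ∸ suc (suc k))))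
          (trans (sym (neg-distribˡ-* 1ℚ (h n))) (cong -_ (*-identityˡ (h n))))

  power : ∀ j i → ((-ₛ x) ^ₛ j) i ≡ entry D i j
  power zero    zero    = refl
  power zero    (suc i) = refl
  power (suc j) zero    = trans (+-identityʳ _) (*-zeroˡ (((-ₛ x) ^ₛ j) 0))
  power (suc j) (suc i) = trans (shift ((-ₛ x) ^ₛ j) i) (trans (cong -_ (power j i)) eq)
    where
    eq : - entry D i j ≡ entry D (suc i) (suc j)
    eq with i ℕₚ.≟ j
    ... | yes refl = trans (cong -_ (diag-on sign i)) (sym (diag-on sign (suc i)))
    ... | no i≢j   = trans (cong -_ (diag-off sign i≢j))
                           (sym (diag-off sign (i≢j ∘ ℕₚ.suc-injective)))

{-# OPTIONS --safe #-}

-- Conjugating by D removes the signs, so the claim is that the inverse of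
-- (1, x(1-x)) is (1, c) and that of (1-2x, x(1-x)) is (1/(1-2c), c), where
-- c = (1 - √(1-4x))/2 satisfies c = c² + x.  The entries of (1/(1-2c), c) are
-- the binomial coefficients C(2i-j, i), and subtracting from each column twice
-- the next one turns it into (1, c).  For a matrix K, multiplying h by x(1+x)
-- before applying K amounts to multiplying K h by x as soon as the columns of K
-- satisfy K_{k+1} + K_{k+2} = x K_k; the columns of (g, x(1+x)) being
-- g (x(1+x))ʲ, such a K is a left inverse once K g = 1.

module Submission where

open import Algebra.Bundles using (CommutativeRing)
open import Data.Integer.Base as ℤ using (+_)
import Data.Integer.Properties as ℤₚ
open import Data.Fin.Base using (toℕ)
open import Data.Nat.Base as ℕ using (ℕ; zero; suc; NonZero; _∸_; _≤_; _<_; z≤n; s≤s)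
open import Data.Nat.Combinatorics
  using (_C_; nC1≡n; nCk≡nC[n∸k]; k>n⇒nCk≡0; nCk+nC[k+1]≡[n+1]C[k+1])
import Data.Nat.Properties as ℕₚ
import Data.Nat.Solver as ℕ-Solver
open import Data.Product.Base using (_×_; _,_; proj₂)
open import Data.Rational using (ℚ; 0ℚ; 1ℚ; ½; _+_; _*_; -_; _-_; _/_)
open import Data.Rational.Properties
  using (+-*-commutativeRing; toℚᵘ-injective; toℚᵘ-fromℚᵘ; toℚᵘ-homo-+; toℚᵘ-homo-*;
         +-identityˡ; +-identityʳ; +-inverseʳ; *-identityˡ; *-identityʳ;
         *-zeroˡ; *-zeroʳ; *-assoc; *-distribˡ-+; *-distribʳ-+)
open import Data.Rational.Solver using (module +-*-Solver)
open import Data.Rational.Unnormalised.Base using (mkℚᵘ; *≡*)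
import Data.Rational.Unnormalised.Properties as ℚᵘₚ
open import Function.Base using (_∘_)
open import Relation.Binary.PropositionalEquality
  using (_≡_; _≢_; refl; sym; trans; cong; cong₂; module ≡-Reasoning)
open import Relation.Nullary using (yes; no)
open import Algebra.Properties.Semiring.Sum
  (CommutativeRing.semiring +-*-commutativeRing) using (∑-distrib-+)
open import Defs
open +-*-Solver using (solve; _:=_; _:+_; _:*_; :-_; _:-_; con)

open ≡-Reasoning

-- Natural numbers inside the rationals.

fromℕ : ℕ → ℚ
fromℕ n = + n / 1

-- `/` divides by a gcd that is stuck on variables, so neither side computes. In the unnormalised
-- rationals the identity becomes an equation of integers.
fromℕ-+ : ∀ m n → fromℕ (m ℕ.+ n) ≡ fromℕ m + fromℕ n
fromℕ-+ m n = toℚᵘ-injective (ℚᵘₚ.≃-trans (toℚᵘ-fromℚᵘ (mkℚᵘ (+ (m ℕ.+ n)) 0))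
  (ℚᵘₚ.≃-sym (ℚᵘₚ.≃-trans (toℚᵘ-homo-+ (fromℕ m) (fromℕ n))
    (ℚᵘₚ.≃-trans (ℚᵘₚ.+-cong (toℚᵘ-fromℚᵘ (mkℚᵘ (+ m) 0)) (toℚᵘ-fromℚᵘ (mkℚᵘ (+ n) 0)))
      (*≡* (cong (ℤ._* + 1)
        (cong₂ ℤ._+_ (ℤₚ.*-identityʳ (+ m)) (ℤₚ.*-identityʳ (+ n)))))))))

fromℕ-* : ∀ m n → fromℕ (m ℕ.* n) ≡ fromℕ m * fromℕ n
fromℕ-* m n = toℚᵘ-injective (ℚᵘₚ.≃-trans (toℚᵘ-fromℚᵘ (mkℚᵘ (+ (m ℕ.* n)) 0))
  (ℚᵘₚ.≃-sym (ℚᵘₚ.≃-trans (toℚᵘ-homo-* (fromℕ m) (fromℕ n))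
    (ℚᵘₚ.≃-trans (ℚᵘₚ.*-cong (toℚᵘ-fromℚᵘ (mkℚᵘ (+ m) 0)) (toℚᵘ-fromℚᵘ (mkℚᵘ (+ n) 0)))
      (*≡* (cong (ℤ._* + 1) (sym (ℤₚ.pos-* m n))))))))

1/n*n≡1 : ∀ n .{{_ : NonZero n}} → (+ 1 / n) * fromℕ n ≡ 1ℚ
1/n*n≡1 (suc n) = toℚᵘ-injective (ℚᵘₚ.≃-trans (toℚᵘ-homo-* (+ 1 / suc n) (fromℕ (suc n)))
  (ℚᵘₚ.≃-trans (ℚᵘₚ.*-cong (toℚᵘ-fromℚᵘ (mkℚᵘ (+ 1) n)) (toℚᵘ-fromℚᵘ (mkℚᵘ (+ suc n) 0)))
    (*≡* (trans (ℤₚ.*-identityʳ _) (cong (λ m → + suc m)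
      (trans (ℕₚ.+-identityʳ n) (sym (trans (ℕₚ.+-identityʳ _) (ℕₚ.*-identityʳ n)))))))))

-- Two identities for binomial coefficients.

-- Absorption, by induction on `n`: Pascal's rule splits the left side, the induction hypothesis
-- lowers both parts to row `n`, and Pascal's rule joins them again.
[k+1]*[n+1]C[k+1]≡[n+1]*nCk : ∀ n k → suc k ℕ.* (suc n C suc k) ≡ suc n ℕ.* (n C k)
[k+1]*[n+1]C[k+1]≡[n+1]*nCk n zero =
  trans (ℕₚ.*-identityˡ _) (trans (nC1≡n (suc n)) (sym (ℕₚ.*-identityʳ (suc n))))
[k+1]*[n+1]C[k+1]≡[n+1]*nCk zero (suc k) =
  trans (cong (suc (suc k) ℕ.*_) (k>n⇒nCk≡0 {1} {suc (suc k)} (s≤s (s≤s z≤n))))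
        (ℕₚ.*-zeroʳ (suc (suc k)))
[k+1]*[n+1]C[k+1]≡[n+1]*nCk (suc n) (suc k) = begin
  suc (suc k) ℕ.* (suc (suc n) C suc (suc k))
    ≡⟨ cong (suc (suc k) ℕ.*_) (nCk+nC[k+1]≡[n+1]C[k+1] (suc n) (suc k)) ⟨
  suc (suc k) ℕ.* (a ℕ.+ b)
    ≡⟨ S.solve 3 (λ k a b → (S.con 2 S.:+ k) S.:* (a S.:+ b)
         S.:= (S.con 1 S.:+ k) S.:* a S.:+ a S.:+ (S.con 2 S.:+ k) S.:* b) refl k a b ⟩
  suc k ℕ.* a ℕ.+ a ℕ.+ suc (suc k) ℕ.* b
    ≡⟨ cong₂ (λ s t → s ℕ.+ a ℕ.+ t) ([k+1]*[n+1]C[k+1]≡[n+1]*nCk n k)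
         ([k+1]*[n+1]C[k+1]≡[n+1]*nCk n (suc k)) ⟩
  suc n ℕ.* (n C k) ℕ.+ a ℕ.+ suc n ℕ.* (n C suc k)
    ≡⟨ S.solve 4 (λ n u v a → (S.con 1 S.:+ n) S.:* u S.:+ a S.:+ (S.con 1 S.:+ n) S.:* v
         S.:= a S.:+ (S.con 1 S.:+ n) S.:* (u S.:+ v)) refl n (n C k) (n C suc k) a ⟩
  a ℕ.+ suc n ℕ.* (n C k ℕ.+ n C suc k)
    ≡⟨ cong (λ t → a ℕ.+ suc n ℕ.* t) (nCk+nC[k+1]≡[n+1]C[k+1] n k) ⟩
  suc (suc n) ℕ.* a ∎
  where
  module S = ℕ-Solver.+-*-Solver
  a = suc n C suc k
  b = suc n C suc (suc k)

[2n+1]Cn≡[2n+1]C[n+1] : ∀ n → suc (2 ℕ.* n) C n ≡ suc (2 ℕ.* n) C suc n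
[2n+1]Cn≡[2n+1]C[n+1] n = trans
  (nCk≡nC[n∸k] (ℕₚ.m≤n⇒m≤1+n (ℕₚ.m≤m+n n (n ℕ.+ 0))))
  (cong (suc (2 ℕ.* n) C_)
    (trans (cong (_∸ n) (trans (cong (λ m → suc (n ℕ.+ m)) (ℕₚ.+-identityʳ n)) (sym (ℕₚ.+-suc n n))))
           (ℕₚ.m+n∸m≡n n (suc n))))

-- Products of power series, with multiplication by x as a shift.

shift : Series → Series
shift h zero    = 0ℚ
shift h (suc n) = h n

shift-cong : ∀ {u v} → (∀ n → u n ≡ v n) → ∀ n → shift u n ≡ shift v n
shift-cong u≗v zero    = refl
shift-cong u≗v (suc n) = u≗v n

∑<-+ : ∀ n (u v : ℕ → ℚ) → ∑< n (λ k → u k + v k) ≡ ∑< n u + ∑< n v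
∑<-+ n u v = ∑-distrib-+ {n} (u ∘ toℕ) (v ∘ toℕ)

∑<-shift : ∀ m (a : ℕ → ℚ) h →
           ∑< (suc m) (λ k → a k * shift h k) ≡ ∑< m (λ k → a (suc k) * h k)
∑<-shift m a h =
  trans (cong (λ t → t + ∑< m (λ k → a (suc k) * h k)) (*-zeroʳ (a 0))) (+-identityˡ _)

*ₛ-congˡ : ∀ g {u v} → (∀ n → u n ≡ v n) → ∀ n → (g *ₛ u) n ≡ (g *ₛ v) n
*ₛ-congˡ g u≗v n = ∑<-cong (suc n) (λ k _ → cong (g k *_) (u≗v (n ∸ k)))

*ₛ-congʳ : ∀ h {u v} → (∀ n → u n ≡ v n) → ∀ n → (u *ₛ h) n ≡ (v *ₛ h) n
*ₛ-congʳ h u≗v n = ∑<-cong (suc n) (λ k _ → cong (_* h (n ∸ k)) (u≗v k))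

*ₛ-distribˡ : ∀ g u v n → (g *ₛ (u +ₛ v)) n ≡ (g *ₛ u) n + (g *ₛ v) n
*ₛ-distribˡ g u v n = trans
  (∑<-cong (suc n) (λ k _ → *-distribˡ-+ (g k) (u (n ∸ k)) (v (n ∸ k))))
  (∑<-+ (suc n) (λ k → g k * u (n ∸ k)) (λ k → g k * v (n ∸ k)))

*ₛ-distribʳ : ∀ h u v n → ((u +ₛ v) *ₛ h) n ≡ (u *ₛ h) n + (v *ₛ h) n
*ₛ-distribʳ h u v n = trans
  (∑<-cong (suc n) (λ k _ → *-distribʳ-+ (h (n ∸ k)) (u k) (v k)))
  (∑<-+ (suc n) (λ k → u k * h (n ∸ k)) (λ k → v k * h (n ∸ k)))

*ₛ-shiftˡ : ∀ u h n → (shift u *ₛ h) n ≡ shift (u *ₛ h) n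
*ₛ-shiftˡ u h zero    = trans (+-identityʳ _) (*-zeroˡ (h 0))
*ₛ-shiftˡ u h (suc n) =
  trans (cong (_+ (u *ₛ h) n) (*-zeroˡ (h (suc n)))) (+-identityˡ _)

*ₛ-shiftʳ : ∀ u h n → (u *ₛ shift h) n ≡ shift (u *ₛ h) n
*ₛ-shiftʳ u h zero    = trans (+-identityʳ _) (*-zeroʳ (u 0))
*ₛ-shiftʳ u h (suc n) = begin
  ∑< (suc (suc n)) t
    ≡⟨ ∑<-snoc (suc n) t ⟩
  ∑< (suc n) t + u (suc n) * shift h (n ∸ n)
    -- For k ≤ n the index `suc n ∸ k` is a successor and the shift cancels it; the split-off last
    -- term meets coefficient 0 of `shift h`.
    ≡⟨ cong₂ _+_
         (∑<-cong (suc n) {t} {λ k → u k * h (n ∸ k)} λ where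
           k (s≤s k≤n) → cong (λ m → u k * shift h m) (ℕₚ.+-∸-assoc 1 k≤n))
         (*0≡0 (u (suc n)) (cong (shift h) (ℕₚ.n∸n≡0 n))) ⟩
  (u *ₛ h) n + 0ℚ
    ≡⟨ +-identityʳ _ ⟩
  (u *ₛ h) n ∎
  where
  t : ℕ → ℚ
  t k = u k * shift h (suc n ∸ k)

constant-*ₛ : ∀ c h n → (constant c *ₛ h) n ≡ c * h n
constant-*ₛ c h n = trans
  (cong (λ t → c * h n + t) (∑<-zero n (λ k _ → *-zeroˡ (h (n ∸ suc k)))))
  (+-identityʳ _)

*ₛ-identityʳ : ∀ h n → (h *ₛ constant 1ℚ) n ≡ h n
*ₛ-identityʳ h n = trans
  (∑<-single (suc n) n {λ k → h k * constant 1ℚ (n ∸ k)} (ℕₚ.n<1+n n) off)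
  (trans (cong (λ m → h n * constant 1ℚ m) (ℕₚ.n∸n≡0 n)) (*-identityʳ (h n)))
  where
  off : ∀ k → k < suc n → k ≢ n → h k * constant 1ℚ (n ∸ k) ≡ 0ℚ
  off k (s≤s k≤n) k≢n =
    *0≡0 (h k) (vanish (ℕₚ.m<n⇒0<n∸m (ℕₚ.≤∧≢⇒< k≤n k≢n)))
    where
    vanish : ∀ {m} → 0 < m → constant 1ℚ m ≡ 0ℚ
    vanish (s≤s _) = refl

x≗shift1 : ∀ n → x n ≡ shift (constant 1ℚ) n
x≗shift1 zero          = refl
x≗shift1 (suc zero)    = refl
x≗shift1 (suc (suc n)) = refl

x*ₛ : ∀ h n → (x *ₛ h) n ≡ shift h n
x*ₛ h n = begin
  (x *ₛ h) n                  ≡⟨ *ₛ-congʳ h x≗shift1 n ⟩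
  (shift (constant 1ℚ) *ₛ h) n ≡⟨ *ₛ-shiftˡ (constant 1ℚ) h n ⟩
  shift (constant 1ℚ *ₛ h) n
    ≡⟨ shift-cong (λ m → trans (constant-*ₛ 1ℚ h m) (*-identityˡ (h m))) n ⟩
  shift h n                   ∎

-- Spelled as in `𝔽ˢ` and `𝕃ˢ`, so that `refl` identifies it with their `f`.
x[1+x] : Series
x[1+x] = x *ₛ (constant 1ℚ +ₛ x)

x[1+x]*ₛ : ∀ h n → (x[1+x] *ₛ h) n ≡ (shift h +ₛ shift (shift h)) n
x[1+x]*ₛ h n = begin
  (x[1+x] *ₛ h) n          ≡⟨ *ₛ-congʳ h (x*ₛ 1+x) n ⟩
  (shift 1+x *ₛ h) n       ≡⟨ *ₛ-shiftˡ 1+x h n ⟩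
  shift (1+x *ₛ h) n       ≡⟨ shift-cong [1+x]*ₛ n ⟩
  shift (h +ₛ shift h) n   ≡⟨ shift-+ n ⟩
  shift h n + shift (shift h) n ∎
  where
  1+x = constant 1ℚ +ₛ x
  [1+x]*ₛ : ∀ m → (1+x *ₛ h) m ≡ h m + shift h m
  [1+x]*ₛ m = trans (*ₛ-distribʳ h (constant 1ℚ) x m)
    (cong₂ _+_ (trans (constant-*ₛ 1ℚ h m) (*-identityˡ (h m))) (x*ₛ h m))
  shift-+ : ∀ m → shift (h +ₛ shift h) m ≡ shift h m + shift (shift h) m
  shift-+ zero    = refl
  shift-+ (suc m) = refl

-- Lower triangular matrices acting on series.

infixr 7 _⊙_

-- Column j of `A · riordan P` is by definition `A` applied to the series `g *ₛ f ^ₛ j`.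
_⊙_ : LowerTriangular → Series → Series
(A ⊙ h) i = ∑< (suc i) (λ k → entry A i k * h k)

⊙-cong : ∀ A {u v} → (∀ n → u n ≡ v n) → ∀ n → (A ⊙ u) n ≡ (A ⊙ v) n
⊙-cong A u≗v i = ∑<-cong (suc i) (λ k _ → cong (entry A i k *_) (u≗v k))

⊙-linear : ∀ A u → (∀ n → u (suc (suc n)) ≡ 0ℚ) →
           ∀ i → (A ⊙ u) i ≡ entry A i 0 * u 0 + entry A i 1 * u 1
-- The sum for row 0 stops at k = 0; triangularity supplies the missing term as zero.
⊙-linear A u u₂₊≡0 zero    = cong (λ t → entry A 0 0 * u 0 + t)
  (sym (0*≡0 (u 1) (lower A (s≤s z≤n))))
⊙-linear A u u₂₊≡0 (suc i) = cong (λ t → entry A (suc i) 0 * u 0 + t)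
  (trans (cong (λ t → entry A (suc i) 1 * u 1 + t)
           (∑<-zero i (λ k _ → *0≡0 (entry A (suc i) (suc (suc k))) (u₂₊≡0 k))))
         (+-identityʳ _))

⊙-x[1+x] : ∀ K →
  (∀ i k → entry K (suc i) (suc k) + entry K (suc i) (suc (suc k)) ≡ entry K i k) →
  ∀ h i → (K ⊙ (shift h +ₛ shift (shift h))) i ≡ shift (K ⊙ h) i
⊙-x[1+x] K rec h zero    = trans (+-identityʳ _) (*-zeroʳ (entry K 0 0))
⊙-x[1+x] K rec h (suc n) = begin
  ∑< (suc (suc n)) (λ k → a k * (shift h k + shift (shift h) k))
    ≡⟨ ∑<-cong (suc (suc n)) (λ k _ → *-distribˡ-+ (a k) (shift h k) (shift (shift h) k)) ⟩
  ∑< (suc (suc n)) (λ k → a k * shift h k + a k * shift (shift h) k)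
    ≡⟨ ∑<-+ (suc (suc n)) (λ k → a k * shift h k) (λ k → a k * shift (shift h) k) ⟩
  ∑< (suc (suc n)) (λ k → a k * shift h k) + ∑< (suc (suc n)) (λ k → a k * shift (shift h) k)
    -- Reindexing moves the shifts from `h` to the columns: one shift leaves n + 1 terms, two leave
    -- n.
    ≡⟨ cong₂ _+_ (∑<-shift (suc n) a h)
         (trans (∑<-shift (suc n) a (shift h)) (∑<-shift n (a ∘ suc) h)) ⟩
  ∑< (suc n) u + ∑< n v
    ≡⟨ cong (λ t → ∑< (suc n) u + t) (+-identityʳ (∑< n v)) ⟨
  ∑< (suc n) u + (∑< n v + 0ℚ)
    -- The shorter sum is padded to n + 1 terms by `v n`, which contains an entry above the
    -- diagonal.
    ≡⟨ cong (λ t → ∑< (suc n) u + (∑< n v + t)) (0*≡0 (h n) (lower K (ℕₚ.n<1+n (suc n)))) ⟨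
  ∑< (suc n) u + (∑< n v + v n)
    ≡⟨ cong (λ t → ∑< (suc n) u + t) (∑<-snoc n v) ⟨
  ∑< (suc n) u + ∑< (suc n) v
    ≡⟨ ∑<-+ (suc n) u v ⟨
  ∑< (suc n) (λ k → u k + v k)
    ≡⟨ ∑<-cong (suc n) (λ k _ → trans (sym (*-distribʳ-+ (h k) (a (suc k)) (a (suc (suc k)))))
                                      (cong (_* h k) (rec n k))) ⟩
  (K ⊙ h) n ∎
  where
  a = entry K (suc n)
  u v : ℕ → ℚ
  u k = a (suc k) * h k
  v k = a (suc (suc k)) * h k

-- Recognising an inverse, and conjugation by D.

-- K = K(AB) = (KA)B = B. It identifies the inverse built by forward substitution without evaluating
-- it.
left≈right-inverse : ∀ {A} K B → K · A ≈ I → A · B ≈ I → K ≈ B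
left≈right-inverse {A} K B KA≈I AB≈I i j = begin
  entry K i j             ≡⟨ ·-identityʳ K i j ⟨
  entry (K · I) i j       ≡⟨ ·-cong {K} {K} {A · B} {I} (λ _ _ → refl) AB≈I i j ⟨
  entry (K · (A · B)) i j ≡⟨ ·-assoc K A B i j ⟨
  entry ((K · A) · B) i j ≡⟨ ·-cong {K · A} {I} {B} {B} KA≈I (λ _ _ → refl) i j ⟩
  entry (I · B) i j       ≡⟨ ·-identityˡ B i j ⟩
  entry B i j             ∎

sign²≡1 : ∀ n → sign n * sign n ≡ 1ℚ
sign²≡1 zero    = refl
sign²≡1 (suc n) = trans (solve 1 (λ s → (:- s) :* (:- s) := s :* s) refl (sign n)) (sign²≡1 n)

conj : LowerTriangular → LowerTriangular
conj A = lowerTriangular (λ i j → sign i * entry A i j * sign j)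
  (λ {i} {j} i<j → 0*≡0 (sign j) (*0≡0 (sign i) (lower A i<j)))

D·A·D≈conj : ∀ A → D · A · D ≈ conj A
D·A·D≈conj A i j with i ℕₚ.<? j
... | yes i<j = trans (lower (D · A · D) i<j) (sym (lower (conj A) i<j))
... | no  i≮j = begin
  entry (D · A · D) i j
    ≡⟨ ∑<-single (suc i) j {λ k → entry (D · A) i k * entry D k j} (s≤s (ℕₚ.≮⇒≥ i≮j))
         (λ k _ k≢j → *0≡0 (entry (D · A) i k) (diag-off sign k≢j)) ⟩
  entry (D · A) i j * entry D j j
    ≡⟨ cong₂ _*_
         (∑<-single (suc i) i {λ k → entry D i k * entry A k j} (ℕₚ.n<1+n i)
           (λ k _ k≢i → 0*≡0 (entry A k j) (diag-off sign (k≢i ∘ sym))))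
         (diag-on sign j) ⟩
  entry D i i * entry A i j * sign j
    ≡⟨ cong (λ d → d * entry A i j * sign j) (diag-on sign i) ⟩
  sign i * entry A i j * sign j ∎

-- A criterion for the conjugated inverse of (g, x(1+x)).

-- The recurrence of the theorem with the negative term moved across, which is Pascal's rule for the
-- binomial coefficients below.
BallotRecurrence : LowerTriangular → Set
BallotRecurrence N = ∀ i k →
  entry N (suc i) (suc k) ≡ entry N (suc i) (suc (suc k)) + entry N i k

module _ (P : RiordanPair) (f≡x[1+x] : RiordanPair.f P ≡ x[1+x])
         (N : LowerTriangular) (ballot : BallotRecurrence N)
         (conj-N⊙g : ∀ i → (conj N ⊙ RiordanPair.g P) i ≡ constant 1ℚ i) where

  open RiordanPair P using (f; g)

  private
    K = conj N

    -- Relative to position (i, k), the signs of column k + 1 cancel in row i + 1 while column k + 2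
    -- keeps one minus, so the difference in the recurrence becomes a sum.
    K-columns : ∀ i k →
      entry K (suc i) (suc k) + entry K (suc i) (suc (suc k)) ≡ entry K i k
    K-columns i k = trans
      (cong (λ t → - sign i * t * - sign k + - sign i * entry N (suc i) (suc (suc k)) * - - sign k)
        (ballot i k))
      (solve 4 (λ s a b t → (:- s) :* (a :+ b) :* (:- t) :+ (:- s) :* a :* (:- (:- t))
                            := s :* b :* t)
        refl (sign i) (entry N (suc i) (suc (suc k))) (entry N i k) (sign k))

    column-suc : ∀ j n → (g *ₛ f ^ₛ suc j) n
                       ≡ (shift (g *ₛ f ^ₛ j) +ₛ shift (shift (g *ₛ f ^ₛ j))) n
    column-suc j n = begin
      (g *ₛ (f *ₛ h)) n
        ≡⟨ *ₛ-congˡ g (λ m → trans (cong (λ u → (u *ₛ h) m) f≡x[1+x]) (x[1+x]*ₛ h m)) n ⟩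
      (g *ₛ (shift h +ₛ shift (shift h))) n
        ≡⟨ *ₛ-distribˡ g (shift h) (shift (shift h)) n ⟩
      (g *ₛ shift h) n + (g *ₛ shift (shift h)) n
        ≡⟨ cong₂ _+_ (*ₛ-shiftʳ g h n)
             (trans (*ₛ-shiftʳ g (shift h) n) (shift-cong (*ₛ-shiftʳ g h) n)) ⟩
      shift (g *ₛ h) n + shift (shift (g *ₛ h)) n ∎
      where h = f ^ₛ j

    -- Induction on the column. Column 0 of `riordan P` is `g`; each next column is the previous one
    -- times x(1+x), which `K` turns into a shift, and shifting a column of `I` gives the next.
    K·P≈I : K · riordan P ≈ I
    K·P≈I i zero = trans (⊙-cong K (*ₛ-identityʳ g) i) (trans (conj-N⊙g i) (column₀ i))
      where
      column₀ : ∀ m → constant 1ℚ m ≡ entry I m 0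
      column₀ zero    = refl
      column₀ (suc m) = refl
    K·P≈I i (suc j) = begin
      (K ⊙ (g *ₛ f ^ₛ suc j)) i ≡⟨ ⊙-cong K (column-suc j) i ⟩
      (K ⊙ (shift h +ₛ shift (shift h))) i ≡⟨ ⊙-x[1+x] K K-columns h i ⟩
      shift (K ⊙ h) i ≡⟨ shift-I i ⟩
      entry I i (suc j) ∎
      where
      h = g *ₛ f ^ₛ j
      shift-I : ∀ m → shift (K ⊙ h) m ≡ entry I m (suc j)
      shift-I zero    = refl
      shift-I (suc m) = K·P≈I m j

  -- The inverse is `conj N`, and conjugating twice squares every sign.
  D·P⁻¹·D≈N : D · P ⁻¹ · D ≈ N
  D·P⁻¹·D≈N i j = begin
    entry (D · P ⁻¹ · D) i j
      ≡⟨ D·A·D≈conj (P ⁻¹) i j ⟩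
    sign i * entry (P ⁻¹) i j * sign j
      ≡⟨ cong (λ t → sign i * t * sign j)
           (left≈right-inverse {riordan P} K (P ⁻¹) K·P≈I (proj₂ (proj₂ (riordan-invertible P))) i j) ⟨
    sign i * (sign i * entry N i j * sign j) * sign j
      ≡⟨ solve 3 (λ s n t → s :* (s :* n :* t) :* t := (s :* s) :* n :* (t :* t))
           refl (sign i) (entry N i j) (sign j) ⟩
    (sign i * sign i) * entry N i j * (sign j * sign j)
      ≡⟨ cong₂ (λ s t → s * entry N i j * t) (sign²≡1 i) (sign²≡1 j) ⟩
    1ℚ * entry N i j * 1ℚ
      ≡⟨ trans (*-identityʳ _) (*-identityˡ _) ⟩
    entry N i j ∎

-- The binomial triangle C(2i-j, i).

-- The number C(2i-j, i), or 0 if j > i.  Row 0 is separate because 0 ∸ j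
-- truncates to 0 and 0 C 0 = 1.
binomial : ℕ → ℕ → ℕ
binomial zero    zero    = 1
binomial zero    (suc j) = 0
binomial (suc i) j       = (2 ℕ.* suc i ∸ j) C suc i

binomial-lower : ∀ {i j} → i < j → binomial i j ≡ 0
binomial-lower {zero}  (s≤s _) = refl
binomial-lower {suc i} {j} i<j = k>n⇒nCk≡0 (s≤s
  (ℕₚ.≤-trans (ℕₚ.∸-monoʳ-≤ (2 ℕ.* suc i) i<j) (ℕₚ.≤-reflexive (begin
    2 ℕ.* suc i ∸ suc (suc i)           ≡⟨ cong (_∸ suc (suc i)) (ℕₚ.*-suc 2 i) ⟩
    i ℕ.+ (i ℕ.+ 0) ∸ i                 ≡⟨ ℕₚ.m+n∸m≡n i (i ℕ.+ 0) ⟩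
    i ℕ.+ 0                             ≡⟨ ℕₚ.+-identityʳ i ⟩
    i                                   ∎))))

-- Pascal's rule for C(2i+1-k, i+1), apart from the cases where subtraction truncates.
binomial-ballot : ∀ i k →
  binomial (suc i) (suc k) ≡ binomial (suc i) (suc (suc k)) ℕ.+ binomial i k
binomial-ballot i k = begin
  (2 ℕ.* suc i ∸ suc k) C suc i
    ≡⟨ cong (λ m → (m ∸ suc k) C suc i) (ℕₚ.*-suc 2 i) ⟩
  (suc (2 ℕ.* i) ∸ k) C suc i
    ≡⟨ pascal i k ⟩
  ((2 ℕ.* i ∸ k) C suc i) ℕ.+ binomial i k
    ≡⟨ cong (λ m → ((m ∸ suc (suc k)) C suc i) ℕ.+ binomial i k) (ℕₚ.*-suc 2 i) ⟨
  ((2 ℕ.* suc i ∸ suc (suc k)) C suc i) ℕ.+ binomial i k ∎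
  where
  pascal : ∀ i k → (suc (2 ℕ.* i) ∸ k) C suc i ≡ ((2 ℕ.* i ∸ k) C suc i) ℕ.+ binomial i k
  pascal zero zero          = refl
  pascal zero (suc zero)    = refl
  pascal zero (suc (suc k)) = refl
  pascal i@(suc i-1) k with k ℕₚ.≤? 2 ℕ.* i
  ... | yes k≤2i = begin
    (suc (2 ℕ.* i) ∸ k) C suc i
      ≡⟨ cong (_C suc i) (ℕₚ.+-∸-assoc 1 k≤2i) ⟩
    suc (2 ℕ.* i ∸ k) C suc i
      ≡⟨ nCk+nC[k+1]≡[n+1]C[k+1] (2 ℕ.* i ∸ k) i ⟨
    ((2 ℕ.* i ∸ k) C i) ℕ.+ ((2 ℕ.* i ∸ k) C suc i)
      ≡⟨ ℕₚ.+-comm ((2 ℕ.* i ∸ k) C i) ((2 ℕ.* i ∸ k) C suc i) ⟩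
    ((2 ℕ.* i ∸ k) C suc i) ℕ.+ ((2 ℕ.* i ∸ k) C i) ∎
  -- Both upper indices truncate to 0; as i is positive here, all three binomials vanish.
  ... | no k≰2i
    rewrite ℕₚ.m≤n⇒m∸n≡0 (ℕₚ.≰⇒> k≰2i) | ℕₚ.m≤n⇒m∸n≡0 (ℕₚ.<⇒≤ (ℕₚ.≰⇒> k≰2i)) = refl

-- Pascal's rule writes a central binomial as a sum of the two middle entries of the preceding odd
-- row, which are equal by symmetry.
binomial-0≡2*1 : ∀ i → binomial (suc i) 0 ≡ binomial (suc i) 1 ℕ.+ binomial (suc i) 1
binomial-0≡2*1 i = central (2 ℕ.* suc i) (ℕₚ.*-suc 2 i)
  where
  central : ∀ m → m ≡ suc (suc (2 ℕ.* i)) →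
            m C suc i ≡ ((m ∸ 1) C suc i) ℕ.+ ((m ∸ 1) C suc i)
  central _ refl = trans (sym (nCk+nC[k+1]≡[n+1]C[k+1] (suc (2 ℕ.* i)) i))
    (cong (ℕ._+ (suc (2 ℕ.* i) C suc i)) ([2n+1]Cn≡[2n+1]C[n+1] i))

-- The two candidate matrices and their first columns.

Q : LowerTriangular
Q = lowerTriangular (λ i j → fromℕ (binomial i j)) (λ i<j → cong fromℕ (binomial-lower i<j))

R : LowerTriangular
R = lowerTriangular (λ i j → entry Q i j - (1ℚ + 1ℚ) * entry Q i (suc j))
  (λ {i} {j} i<j → cong₂ (λ s t → s - (1ℚ + 1ℚ) * t) (lower Q i<j) (lower Q (ℕₚ.m<n⇒m<1+n i<j)))

Q-ballot : BallotRecurrence Q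
Q-ballot i k = trans (cong fromℕ (binomial-ballot i k))
  (fromℕ-+ (binomial (suc i) (suc (suc k))) (binomial i k))

-- The recurrence is linear and invariant under moving all columns by one, so `R` inherits it from
-- `Q`.
R-ballot : BallotRecurrence R
R-ballot i k = trans
  (cong₂ (λ s t → s - (1ℚ + 1ℚ) * t) (Q-ballot i k) (Q-ballot i (suc k)))
  (solve 5 (λ c a b d e → (a :+ b) :- c :* (d :+ e) := (a :- c :* d) :+ (b :- c :* e))
    refl (1ℚ + 1ℚ) (entry Q (suc i) (suc (suc k))) (entry Q i k)
    (entry Q (suc i) (suc (suc (suc k)))) (entry Q i (suc k)))

-- False in row 0, where the entries are 1 and 0. It makes column 0 of `R` vanish below the top,
-- makes `conj Q` send 1+2x to 1, and gives the factor ½ in column 1.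
Q-column₀ : ∀ i → entry Q (suc i) 0 ≡ (1ℚ + 1ℚ) * entry Q (suc i) 1
Q-column₀ i = begin
  entry Q (suc i) 0
    ≡⟨ trans (cong fromℕ (binomial-0≡2*1 i)) (fromℕ-+ (binomial (suc i) 1) (binomial (suc i) 1)) ⟩
  q + q
    ≡⟨ cong₂ _+_ (*-identityˡ q) (*-identityˡ q) ⟨
  1ℚ * q + 1ℚ * q
    ≡⟨ *-distribʳ-+ q 1ℚ 1ℚ ⟨
  (1ℚ + 1ℚ) * q ∎
  where q = entry Q (suc i) 1

R-column₀ : ∀ i → entry R (suc i) 0 ≡ 0ℚ
R-column₀ i = trans
  (cong (λ t → t - (1ℚ + 1ℚ) * entry Q (suc i) 1) (Q-column₀ i))
  (+-inverseʳ ((1ℚ + 1ℚ) * entry Q (suc i) 1))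

-- The Catalan numbers: with i = n + 1, Pascal's rule reduces the entry to C(2n, n) - C(2n, n+1),
-- which is C(2n, n)/(n+1).
R-column₁ : ∀ i .{{_ : NonZero i}} →
            entry R i 1 ≡ (+ 1 / i) * fromℕ ((2 ℕ.* i ∸ 2) C (i ∸ 1))
R-column₁ (suc n) = begin
  fromℕ ((2 ℕ.* suc n ∸ 1) C suc n) - (1ℚ + 1ℚ) * fromℕ ((2 ℕ.* suc n ∸ 2) C suc n)
    ≡⟨ cong (λ m → fromℕ ((m ∸ 1) C suc n) - (1ℚ + 1ℚ) * fromℕ ((m ∸ 2) C suc n)) (ℕₚ.*-suc 2 n) ⟩
  fromℕ (suc (2 ℕ.* n) C suc n) - (1ℚ + 1ℚ) * b
    ≡⟨ cong (λ t → t - (1ℚ + 1ℚ) * b) c≡a+b ⟩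
  (a + b) - (1ℚ + 1ℚ) * b
    ≡⟨ solve 2 (λ a b → (a :+ b) :- con (1ℚ + 1ℚ) :* b := a :- b) refl a b ⟩
  a - b
    ≡⟨ *-identityˡ _ ⟨
  1ℚ * (a - b)
    ≡⟨ cong (_* (a - b)) (1/n*n≡1 (suc n)) ⟨
  (+ 1 / suc n) * N * (a - b)
    ≡⟨ *-assoc (+ 1 / suc n) N (a - b) ⟩
  (+ 1 / suc n) * (N * (a - b))
    ≡⟨ cong ((+ 1 / suc n) *_) catalan ⟩
  (+ 1 / suc n) * a
    ≡⟨ cong (λ m → (+ 1 / suc n) * fromℕ ((m ∸ 2) C n)) (ℕₚ.*-suc 2 n) ⟨
  (+ 1 / suc n) * fromℕ ((2 ℕ.* suc n ∸ 2) C n) ∎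
  where
  N = fromℕ (suc n)
  a = fromℕ ((2 ℕ.* n) C n)
  b = fromℕ ((2 ℕ.* n) C suc n)

  c≡a+b : fromℕ (suc (2 ℕ.* n) C suc n) ≡ a + b
  c≡a+b = trans (cong fromℕ (sym (nCk+nC[k+1]≡[n+1]C[k+1] (2 ℕ.* n) n)))
                (fromℕ-+ ((2 ℕ.* n) C n) ((2 ℕ.* n) C suc n))

  M = fromℕ n

  N≡1+M : N ≡ 1ℚ + M
  N≡1+M = fromℕ-+ 1 n

  -- Absorption in row 2n, with 2n + 1 written as `N + M`.
  absorbed : N * (a + b) ≡ (N + M) * a
  absorbed = begin
    N * (a + b)                       ≡⟨ cong (N *_) c≡a+b ⟨
    N * fromℕ (suc (2 ℕ.* n) C suc n) ≡⟨ fromℕ-* (suc n) (suc (2 ℕ.* n) C suc n) ⟨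
    fromℕ (suc n ℕ.* (suc (2 ℕ.* n) C suc n))
      ≡⟨ cong fromℕ ([k+1]*[n+1]C[k+1]≡[n+1]*nCk (2 ℕ.* n) n) ⟩
    fromℕ (suc (2 ℕ.* n) ℕ.* ((2 ℕ.* n) C n)) ≡⟨ fromℕ-* (suc (2 ℕ.* n)) ((2 ℕ.* n) C n) ⟩
    fromℕ (suc (2 ℕ.* n)) * a
      ≡⟨ cong (_* a) (trans (cong (λ m → fromℕ (suc (n ℕ.+ m))) (ℕₚ.+-identityʳ n)) (fromℕ-+ (suc n) n)) ⟩
    (N + M) * a ∎

  catalan : N * (a - b) ≡ a
  catalan = begin
    N * (a - b)
      -- Rewriting a - b as 2a - (a + b) brings in the sum that `absorbed` evaluates.
      ≡⟨ solve 3 (λ N a b → N :* (a :- b) := N :* a :+ N :* a :- N :* (a :+ b)) refl N a b ⟩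
    N * a + N * a - N * (a + b)
      ≡⟨ cong (λ t → N * a + N * a - t) absorbed ⟩
    N * a + N * a - (N + M) * a
      ≡⟨ solve 3 (λ N M a → N :* a :+ N :* a :- (N :+ M) :* a := (N :- M) :* a) refl N M a ⟩
    (N - M) * a
      ≡⟨ cong (λ t → (t - M) * a) N≡1+M ⟩
    (1ℚ + M - M) * a
      ≡⟨ solve 2 (λ M a → (con 1ℚ :+ M :- M) :* a := a) refl M a ⟩
    a ∎

-- The inverses of the two Riordan matrices and their entries.

D·𝔽ˢ⁻¹·D≈R : D · 𝔽ˢ ⁻¹ · D ≈ R
D·𝔽ˢ⁻¹·D≈R = D·P⁻¹·D≈N 𝔽ˢ refl R R-ballot λ i →
  trans (⊙-linear (conj R) (constant 1ℚ) (λ _ → refl) i) (column i)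
  where
  column : ∀ i → entry (conj R) i 0 * 1ℚ + entry (conj R) i 1 * 0ℚ ≡ constant 1ℚ i
  column zero    = refl
  column (suc i) = trans
    (cong (λ t → - sign i * t * 1ℚ * 1ℚ + entry (conj R) (suc i) 1 * 0ℚ) (R-column₀ i))
    (solve 2 (λ s t → (:- s) :* con 0ℚ :* con 1ℚ :* con 1ℚ :+ t :* con 0ℚ := con 0ℚ)
      refl (sign i) (entry (conj R) (suc i) 1))

D·𝕃ˢ⁻¹·D≈Q : D · 𝕃ˢ ⁻¹ · D ≈ Q
D·𝕃ˢ⁻¹·D≈Q = D·P⁻¹·D≈N 𝕃ˢ refl Q Q-ballot λ i →
  trans (⊙-linear (conj Q) (RiordanPair.g 𝕃ˢ)
          (λ n → trans (+-identityˡ _) (trans (constant-*ₛ (1ℚ + 1ℚ) x (suc (suc n))) (*-zeroʳ (1ℚ + 1ℚ))))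
          i)
        (column i)
  where
  column : ∀ i → entry (conj Q) i 0 * 1ℚ + entry (conj Q) i 1 * (1ℚ + 1ℚ) ≡ constant 1ℚ i
  column zero    = refl
  column (suc i) = trans
    (cong (λ t → - sign i * t * 1ℚ * 1ℚ + entry (conj Q) (suc i) 1 * (1ℚ + 1ℚ)) (Q-column₀ i))
    -- Column 1 carries the sign `- 1ℚ`, so twice it cancels column 0.
    (solve 2 (λ s t → (:- s) :* (con (1ℚ + 1ℚ) :* t) :* con 1ℚ :* con 1ℚ
                      :+ (:- s) :* t :* con (- 1ℚ) :* con (1ℚ + 1ℚ) := con 0ℚ)
      refl (sign i) (entry Q (suc i) 1))

ballot⇒recurrence : ∀ {A N} → A ≈ N → BallotRecurrence N → ∀ i j → 1 ≤ i → 2 ≤ j →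
  entry A i j ≡ - entry A (i ∸ 1) (j ∸ 2) + entry A i (j ∸ 1)
ballot⇒recurrence {A} {N} A≈N ballot (suc i) (suc (suc k)) _ (s≤s (s≤s _)) = begin
  entry A (suc i) (suc (suc k))
    ≡⟨ A≈N (suc i) (suc (suc k)) ⟩
  n
    ≡⟨ solve 2 (λ n m → n := :- m :+ (n :+ m)) refl n (entry N i k) ⟩
  - entry N i k + (n + entry N i k)
    ≡⟨ cong (λ t → - entry N i k + t) (ballot i k) ⟨
  - entry N i k + entry N (suc i) (suc k)
    ≡⟨ cong₂ (λ s t → - s + t) (A≈N i k) (A≈N (suc i) (suc k)) ⟨
  - entry A i k + entry A (suc i) (suc k) ∎
  where n = entry N (suc i) (suc (suc k))

theorem3p2 :
  let r = entry (D · 𝔽ˢ ⁻¹ · D)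
      q = entry (D · 𝕃ˢ ⁻¹ · D)
  in ( r 0 0 ≡ 1ℚ
     × (∀ (i : ℕ) → 1 ≤ i → r i 0 ≡ 0ℚ)
     × (∀ (i : ℕ) .{{_ : NonZero i}} → r i 1 ≡ (+ 1 / i) * (+ ((2 ℕ.* i ∸ 2) C (i ∸ 1)) / 1))
     × (∀ (i j : ℕ) → 1 ≤ i → 2 ≤ j → r i j ≡ - r (i ∸ 1) (j ∸ 2) + r i (j ∸ 1)) )
   × ( (∀ (i : ℕ) → q i 0 ≡ + ((2 ℕ.* i) C i) / 1)
     × (∀ (i : ℕ) → 1 ≤ i → q i 1 ≡ ½ * (+ ((2 ℕ.* i) C i) / 1))
     × (∀ (i j : ℕ) → 1 ≤ i → 2 ≤ j → q i j ≡ - q (i ∸ 1) (j ∸ 2) + q i (j ∸ 1)) )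
theorem3p2 =
  ( D·𝔽ˢ⁻¹·D≈R 0 0
  , (λ { (suc i) _ → trans (D·𝔽ˢ⁻¹·D≈R (suc i) 0) (R-column₀ i) })
  , (λ i → trans (D·𝔽ˢ⁻¹·D≈R i 1) (R-column₁ i))
  , ballot⇒recurrence {D · 𝔽ˢ ⁻¹ · D} {R} D·𝔽ˢ⁻¹·D≈R R-ballot )
  , ( (λ i → trans (D·𝕃ˢ⁻¹·D≈Q i 0) (q₀ i))
    , (λ { (suc i) _ → trans (D·𝕃ˢ⁻¹·D≈Q (suc i) 1) (q₁ i) })
    , ballot⇒recurrence {D · 𝕃ˢ ⁻¹ · D} {Q} D·𝕃ˢ⁻¹·D≈Q Q-ballot )
  where
  q₀ : ∀ i → entry Q i 0 ≡ fromℕ ((2 ℕ.* i) C i)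
  q₀ zero    = refl
  q₀ (suc i) = refl

  q₁ : ∀ i → entry Q (suc i) 1 ≡ ½ * fromℕ ((2 ℕ.* suc i) C suc i)
  q₁ i = begin
    -- `½ * (1ℚ + 1ℚ)` evaluates to `1ℚ`.
    entry Q (suc i) 1                   ≡⟨ *-identityˡ _ ⟨
    ½ * (1ℚ + 1ℚ) * entry Q (suc i) 1   ≡⟨ *-assoc ½ (1ℚ + 1ℚ) (entry Q (suc i) 1) ⟩
    ½ * ((1ℚ + 1ℚ) * entry Q (suc i) 1) ≡⟨ cong (½ *_) (Q-column₀ i) ⟨
    ½ * entry Q (suc i) 0               ∎
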